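{- Suppose that $R$ is a ring and let $F\in R[\mathbf p][[t,t_1,\dots,t_r]]$ be a formal power series such that for each $n\ge0$, $[t^n]F$ is a homogeneous polynomial in $\mathbf p$ of degree $n$, where $\deg(p_i):=i$. Suppose that there exists an operator $A$ such that: 1. $\big(t\frac{d}{dt}+s^kA\big)F=0$ for a positive integer $k$, with $s\in\{t,t_1,\dots,t_r\}$ and $A$ independent of $s$; 2. $p_i^*F\big|_{s=0}=0$ for each positive integer $i$; 3. $[t^n]L_iF$ is a homogeneous polynomial in $\mathbf p$ of degree $n-i$, where the operators $L_i$ are those defined in 4; 4. $A=\sum_{i\ge1}p_i\tilde L_i$, where the operators $L_{i-k\delta_{s,t}}:=\frac{p_i^*}{s^k}+\tilde L_i$ represent the Virasoro algebra, i.e. $[L_i,L_j]=(i-j)L_{i+j}$. Then the function $F$ satisfies the following Virasoro constraints: $L_iF=0$ for each $i\ge1-k\delta_{s,t}$.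
   Context: $\mathbf p=(p_1,p_2,\dots)$ is an infinite family of variables and $p_i^*:=i\,\partial/\partial p_i$. $\delta_{s,t}$ equals $1$ if $s$ is the variable $t$ and $0$ otherwise. $[t^n]$ denotes extraction of the coefficient of $t^n$.
   Formalization: The ring R is assumed torsion-free (the claim fails otherwise, e.g. over F_2), and the Virasoro relations are required to stay within the family of L_i, which excludes s = t with k ≥ 3, where L_{i+j} can be undefined and the claim fails. -}

module Defs where

open import Level using (Level; _⊔_)
open import Algebra.Bundles using (Ring)
open import Algebra.Module.Bundles.Raw using (RawLeftModule)
open import Algebra.Module.Morphism.Structures using (module LeftModuleMorphisms)
import Algebra.Definitions.RawMonoid as RawMonoidDefinitions
import Algebra.Properties.Ring as RingProperties
open import Data.Fin.Base using (Fin; zero; suc)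
open import Data.Integer.Base as ℤ using (ℤ; +_; -[1+_]; 1ℤ)
import Data.Integer.Properties as ℤₚ
open import Data.List.Base using (List; []; _∷_; _++_; [_])
open import Data.Nat.Base as ℕ using (ℕ; zero; suc; pred)
import Data.Nat.Properties as ℕₚ
open import Data.Nat.Tactic.RingSolver using (solve-∀)
open import Data.Product.Base using (∃; _×_; _,_; proj₁; proj₂)
open import Data.Sum.Base using (_⊎_; inj₁; inj₂)
open import Data.Vec.Base as Vec using (Vec; insertAt; lookup)
open import Relation.Binary.PropositionalEquality
  using (_≡_; _≢_; refl; sym; trans; cong; subst)

-- A monomial in p₁, p₂, … is its list of exponents, up to trailing zeros.
-- Everywhere below, the variable p_{i+1} is referred to by the number i : ℕ.
Monomial : Set
Monomial = List ℕ

exponent : ℕ → Monomial → ℕ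
exponent i       []      = 0
exponent zero    (x ∷ e) = x
exponent (suc i) (x ∷ e) = exponent i e

incr : ℕ → Monomial → Monomial
incr zero    []      = 1 ∷ []
incr (suc i) []      = 0 ∷ incr i []
incr zero    (x ∷ e) = suc x ∷ e
incr (suc i) (x ∷ e) = x ∷ incr i e

decr : ℕ → Monomial → Monomial
decr i       []      = []
decr zero    (x ∷ e) = pred x ∷ e
decr (suc i) (x ∷ e) = x ∷ decr i e

degreeFrom : ℕ → Monomial → ℕ
degreeFrom w []      = 0
degreeFrom w (x ∷ e) = w ℕ.* x ℕ.+ degreeFrom (suc w) e

degree : Monomial → ℕ
degree = degreeFrom 1

exponent-++0 : ∀ i e → exponent i (e ++ [ 0 ]) ≡ exponent i e
exponent-++0 zero    []      = refl
exponent-++0 (suc i) []      = refl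
exponent-++0 zero    (x ∷ e) = refl
exponent-++0 (suc i) (x ∷ e) = exponent-++0 i e

decr-++0 : ∀ i e → decr i (e ++ [ 0 ]) ≡ decr i e ++ [ 0 ]
decr-++0 zero    []      = refl
decr-++0 (suc i) []      = refl
decr-++0 zero    (x ∷ e) = refl
decr-++0 (suc i) (x ∷ e) = cong (x ∷_) (decr-++0 i e)

incr-++0 : ∀ i e → incr i (e ++ [ 0 ]) ≡ incr i e ⊎ incr i (e ++ [ 0 ]) ≡ incr i e ++ [ 0 ]
incr-++0 zero    []      = inj₁ refl
incr-++0 (suc i) []      = inj₁ refl
incr-++0 zero    (x ∷ e) = inj₂ refl
incr-++0 (suc i) (x ∷ e) with incr-++0 i e
... | inj₁ p = inj₁ (cong (x ∷_) p)
... | inj₂ p = inj₂ (cong (x ∷_) p)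

degreeFrom-incr : ∀ w i e → degreeFrom w (incr i e) ≡ (w ℕ.+ i) ℕ.+ degreeFrom w e
degreeFrom-incr w zero    []      = lem w
  where lem : ∀ w → w ℕ.* 1 ℕ.+ 0 ≡ w ℕ.+ 0 ℕ.+ 0
        lem = solve-∀
degreeFrom-incr w (suc i) []      =
  trans (cong (w ℕ.* 0 ℕ.+_) (degreeFrom-incr (suc w) i [])) (lem w i)
  where lem : ∀ w i → w ℕ.* 0 ℕ.+ (suc w ℕ.+ i ℕ.+ 0) ≡ w ℕ.+ suc i ℕ.+ 0
        lem = solve-∀
degreeFrom-incr w zero    (x ∷ e) = lem w x (degreeFrom (suc w) e)
  where lem : ∀ w x d → w ℕ.* suc x ℕ.+ d ≡ w ℕ.+ 0 ℕ.+ (w ℕ.* x ℕ.+ d)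
        lem = solve-∀
degreeFrom-incr w (suc i) (x ∷ e) =
  trans (cong (w ℕ.* x ℕ.+_) (degreeFrom-incr (suc w) i e)) (lem w i x (degreeFrom (suc w) e))
  where lem : ∀ w i x d → w ℕ.* x ℕ.+ (suc w ℕ.+ i ℕ.+ d) ≡ w ℕ.+ suc i ℕ.+ (w ℕ.* x ℕ.+ d)
        lem = solve-∀

incr-decr : ∀ i e {m} → exponent i e ≡ suc m → incr i (decr i e) ≡ e
incr-decr zero    (suc x ∷ e) eq = refl
incr-decr (suc i) (x ∷ e)     eq = cong (x ∷_) (incr-decr i e eq)

degree-decr : ∀ i e {m} → exponent i e ≡ suc m → degree e ≡ suc i ℕ.+ degree (decr i e)
degree-decr i e eq =
  trans (cong degree (sym (incr-decr i e eq))) (degreeFrom-incr 1 i (decr i e))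

TorsionFree : ∀ {c ℓ} → Ring c ℓ → Set (c ⊔ ℓ)
TorsionFree R = ∀ n x → suc n ×ᴿ x ≈ 0# → x ≈ 0#
  where
  open Ring R
  open RawMonoidDefinitions +-rawMonoid using () renaming (_×_ to _×ᴿ_)

-- The variables t, t₁, …, t_r are numbered by Fin (suc r), with t = zero.
δₜ : ∀ {r} → Fin (suc r) → ℕ
δₜ zero    = 1
δₜ (suc _) = 0

module Polynomials {c ℓ : Level} (R : Ring c ℓ) where

  open Ring R using (Carrier; _≈_; _+_; _*_; -_; 0#)
  private module R = Ring R
  open RawMonoidDefinitions R.+-rawMonoid using () renaming (_×_ to _×ᴿ_)

  infixr 8 _·_
  _·_ : ℤ → Carrier → Carrier
  (+ n)    · x = n ×ᴿ x
  -[1+ n ] · x = - (suc n ×ᴿ x)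

  private
    ×ᴿ-cong : ∀ n {x y} → x ≈ y → n ×ᴿ x ≈ n ×ᴿ y
    ×ᴿ-cong zero    p = R.refl
    ×ᴿ-cong (suc n) p = R.+-cong p (×ᴿ-cong n p)

    ×ᴿ-zero : ∀ n → n ×ᴿ 0# ≈ 0#
    ×ᴿ-zero zero    = R.refl
    ×ᴿ-zero (suc n) = R.trans (R.+-identityˡ _) (×ᴿ-zero n)

    -0#≈0# : - 0# ≈ 0#
    -0#≈0# = RingProperties.-0#≈0# R

  ·-cong : ∀ n {x y} → x ≈ y → n · x ≈ n · y
  ·-cong (+ n)    p = ×ᴿ-cong n p
  ·-cong -[1+ n ] p = R.-‿cong (×ᴿ-cong (suc n) p)

  ·-zero : ∀ n → n · 0# ≈ 0#
  ·-zero (+ n)    = ×ᴿ-zero n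
  ·-zero -[1+ n ] = R.trans (R.-‿cong (×ᴿ-zero (suc n))) -0#≈0#

  -- R[p].  There are finitely many monomials of each degree, so `bounded`
  -- says that the support is finite.
  record Poly : Set (c ⊔ ℓ) where
    field
      coeff    : Monomial → Carrier
      trailing : ∀ e → coeff (e ++ [ 0 ]) ≈ coeff e
      bounded  : ∃ λ N → ∀ e → N ℕ.< degree e → coeff e ≈ 0#

  open Poly public

  infix 4 _≈ᴾ_
  _≈ᴾ_ : Poly → Poly → Set ℓ
  f ≈ᴾ g = ∀ e → coeff f e ≈ coeff g e

  0ᴾ : Poly
  0ᴾ = record { coeff = λ _ → 0# ; trailing = λ _ → R.refl ; bounded = 0 , λ _ _ → R.refl }

  infixl 6 _+ᴾ_
  _+ᴾ_ : Poly → Poly → Poly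
  f +ᴾ g = record
    { coeff    = λ e → coeff f e + coeff g e
    ; trailing = λ e → R.+-cong (trailing f e) (trailing g e)
    ; bounded  = proj₁ (bounded f) ℕ.+ proj₁ (bounded g) , λ e N<d → R.trans
        (R.+-cong (proj₂ (bounded f) e (ℕₚ.≤-<-trans (ℕₚ.m≤m+n _ _) N<d))
                  (proj₂ (bounded g) e (ℕₚ.≤-<-trans (ℕₚ.m≤n+m _ _) N<d)))
        (R.+-identityˡ 0#)
    }

  mapCoeff : (h : Carrier → Carrier) → (∀ {x y} → x ≈ y → h x ≈ h y) → h 0# ≈ 0# → Poly → Poly
  mapCoeff h h-cong h-zero f = record
    { coeff    = λ e → h (coeff f e)
    ; trailing = λ e → h-cong (trailing f e)
    ; bounded  = proj₁ (bounded f) ,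
                 λ e N<d → R.trans (h-cong (proj₂ (bounded f) e N<d)) h-zero
    }

  -ᴾ_ : Poly → Poly
  -ᴾ_ = mapCoeff -_ R.-‿cong -0#≈0#

  infixr 7 _*ᴾ_ _·ᴾ_
  _*ᴾ_ : Carrier → Poly → Poly
  a *ᴾ f = mapCoeff (a *_) (R.*-cong R.refl) (R.zeroʳ a) f

  _·ᴾ_ : ℤ → Poly → Poly
  n ·ᴾ f = mapCoeff (n ·_) (·-cong n) (·-zero n) f

  p*-coeff : ℕ → (Monomial → Carrier) → Monomial → Carrier
  p*-coeff i f e = (suc i ℕ.* suc (exponent i e)) ×ᴿ f (incr i e)

  -- (i+1) ∂/∂p_{i+1}
  p* : ℕ → Poly → Poly
  p* i f = record
    { coeff    = p*-coeff i (coeff f)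
    ; trailing = trail
    ; bounded  = proj₁ (bounded f) , λ e N<d → R.trans
        (×ᴿ-cong (suc i ℕ.* suc (exponent i e)) (proj₂ (bounded f) (incr i e)
          (ℕₚ.<-≤-trans N<d (subst (degree e ℕ.≤_) (sym (degreeFrom-incr 1 i e))
                                   (ℕₚ.m≤n+m (degree e) (suc i))))))
        (×ᴿ-zero (suc i ℕ.* suc (exponent i e)))
    }
    where
    trail : ∀ e → p*-coeff i (coeff f) (e ++ [ 0 ]) ≈ p*-coeff i (coeff f) e
    trail e rewrite exponent-++0 i e with incr-++0 i e
    ... | inj₁ eq rewrite eq = R.refl
    ... | inj₂ eq rewrite eq = ×ᴿ-cong (suc i ℕ.* suc (exponent i e)) (trailing f (incr i e))

  ifPositive : ℕ → Carrier → Carrier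
  ifPositive zero    x = 0#
  ifPositive (suc _) x = x

  -- Multiplication by p_{i+1}
  mulP : ℕ → Poly → Poly
  mulP i f = record
    { coeff    = λ e → ifPositive (exponent i e) (coeff f (decr i e))
    ; trailing = trail
    ; bounded  = suc i ℕ.+ proj₁ (bounded f) , bound
    }
    where
    trail : ∀ e → ifPositive (exponent i (e ++ [ 0 ])) (coeff f (decr i (e ++ [ 0 ])))
                ≈ ifPositive (exponent i e) (coeff f (decr i e))
    trail e rewrite exponent-++0 i e | decr-++0 i e with exponent i e
    ... | zero  = R.refl
    ... | suc _ = trailing f (decr i e)

    bound : ∀ e → suc i ℕ.+ proj₁ (bounded f) ℕ.< degree e →
            ifPositive (exponent i e) (coeff f (decr i e)) ≈ 0#
    bound e N<d with exponent i e in eq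
    ... | zero  = R.refl
    ... | suc _ = proj₂ (bounded f) (decr i e)
                    (ℕₚ.+-cancelˡ-< (suc i) _ _ (subst (_ ℕ.<_) (degree-decr i e eq) N<d))

  Homogeneous : ℤ → Poly → Set ℓ
  Homogeneous d f = ∀ e → + degree e ≢ d → coeff f e ≈ 0#

module Series {c ℓ : Level} (R : Ring c ℓ) (n : ℕ) where

  open Ring R using (Carrier; _≈_; _+_; 0#)
  open Polynomials R

  -- R[p][[x₁,…,xₙ]]
  Power : Set (c ⊔ ℓ)
  Power = Vec ℕ n → Poly

  infix 4 _≈ᵁ_
  _≈ᵁ_ : Power → Power → Set ℓ
  u ≈ᵁ v = ∀ a → u a ≈ᴾ v a

  rawLeftModule : RawLeftModule Carrier (c ⊔ ℓ) ℓ
  rawLeftModule = record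
    { Carrierᴹ = Power
    ; _≈ᴹ_     = _≈ᵁ_
    ; _+ᴹ_     = λ u v a → u a +ᴾ v a
    ; _*ₗ_     = λ x u a → x *ᴾ u a
    ; 0ᴹ       = λ _ → 0ᴾ
    ; -ᴹ_      = λ u a → -ᴾ u a
    }

  open RawLeftModule rawLeftModule public
    using () renaming (_+ᴹ_ to _+ᵁ_; 0ᴹ to 0ᵁ; -ᴹ_ to -ᵁ_)

  -- Continuity for the product topology, R[p] being discrete: each coefficient
  -- of the image depends on finitely many coefficients of the argument.
  Continuous : (Power → Power) → Set (c ⊔ ℓ)
  Continuous T = ∀ a → ∃ λ N → ∀ u →
    (∀ b → Vec.sum b ℕ.≤ N → u b ≈ᴾ 0ᴾ) → T u a ≈ᴾ 0ᴾ

  record Operator : Set (c ⊔ ℓ) where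
    field
      ⟦_⟧        : Power → Power
      isLinear   : LeftModuleMorphisms.IsLeftModuleHomomorphism rawLeftModule rawLeftModule ⟦_⟧
      continuous : Continuous ⟦_⟧

    open LeftModuleMorphisms.IsLeftModuleHomomorphism isLinear public

  open Operator public using (⟦_⟧)

  partialSum : (ℕ → Power) → ℕ → Power
  partialSum u zero    = 0ᵁ
  partialSum u (suc m) = partialSum u m +ᵁ u m

  -- v = Σᵢ uᵢ as formal series in p, x₁,…,xₙ: every coefficient of the partial
  -- sums is eventually equal to that of v.
  _IsSumOf_ : Power → (ℕ → Power) → Set ℓ
  v IsSumOf u = ∀ a e → ∃ λ N → ∀ m → N ℕ.≤ m →
    coeff (partialSum u m a) e ≈ coeff (v a) e

  _≈Σp_ : Operator → (ℕ → Operator) → Set (c ⊔ ℓ)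
  A ≈Σp L̃ = ∀ u → ⟦ A ⟧ u IsSumOf (λ i a → mulP i (⟦ L̃ i ⟧ u a))

-- An operator independent of the variable s is an operator on series in the
-- remaining r variables, extended to series in s coefficient by coefficient.
module Constraints {c ℓ : Level} (R : Ring c ℓ) {r : ℕ} (s : Fin (suc r)) (k : ℕ) where

  open Polynomials R public
  open Series R r public
  private
    module R = Ring R
    module All = Series R (suc r)

  -- R[p][[t,t₁,…,t_r]]
  FullSeries : Set (c ⊔ ℓ)
  FullSeries = All.Power

  -- Laurent series in s over R[p][[remaining variables]]
  record Laurent : Set (c ⊔ ℓ) where
    field
      slice : ℤ → Power
      below : ∃ λ b → ∀ m → m ℤ.< b → slice m ≈ᵁ 0ᵁ

  open Laurent public

  infix 4 _≈ᴸ_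
  _≈ᴸ_ : Laurent → Laurent → Set ℓ
  G ≈ᴸ H = ∀ m → slice G m ≈ᵁ slice H m

  0ᴸ : Laurent
  0ᴸ = record { slice = λ _ → 0ᵁ ; below = + 0 , λ _ _ _ _ → R.refl }

  infixl 6 _+ᴸ_ _-ᴸ_
  _+ᴸ_ : Laurent → Laurent → Laurent
  G +ᴸ H = record
    { slice = λ m → slice G m +ᵁ slice H m
    ; below = proj₁ (below G) ℤ.⊓ proj₁ (below H) , λ m m<b a e → R.trans
        (R.+-cong (proj₂ (below G) m (ℤₚ.<-≤-trans m<b (ℤₚ.i⊓j≤i _ _)) a e)
                  (proj₂ (below H) m (ℤₚ.<-≤-trans m<b (ℤₚ.i⊓j≤j _ _)) a e))
        (R.+-identityˡ R.0#)
    }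

  mapSlice : (h : ℤ → Power → Power) → (∀ m u → u ≈ᵁ 0ᵁ → h m u ≈ᵁ 0ᵁ) → Laurent → Laurent
  mapSlice h h-zero G = record
    { slice = λ m → h m (slice G m)
    ; below = proj₁ (below G) , λ m m<b → h-zero m (slice G m) (proj₂ (below G) m m<b)
    }

  private
    ·-zero′ : ∀ z {x} → x R.≈ R.0# → z · x R.≈ R.0#
    ·-zero′ z p = R.trans (·-cong z p) (·-zero z)

  infixr 7 _·ᴸ_
  _·ᴸ_ : ℤ → Laurent → Laurent
  z ·ᴸ G = mapSlice (λ _ u a → z ·ᴾ u a) (λ _ u p a e → ·-zero′ z (p a e)) G

  _-ᴸ_ : Laurent → Laurent → Laurent
  G -ᴸ H = G +ᴸ (ℤ.- 1ℤ) ·ᴸ H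

  -- Multiplication by s^d
  s^_∙_ : ℤ → Laurent → Laurent
  s^ d ∙ G = record
    { slice = λ m → slice G (m ℤ.- d)
    ; below = proj₁ (below G) ℤ.+ d , λ m m<b → proj₂ (below G) (m ℤ.- d)
        (subst (m ℤ.- d ℤ.<_) (cancel (proj₁ (below G))) (ℤₚ.+-monoˡ-< (ℤ.- d) m<b))
    }
    where
    cancel : ∀ b → b ℤ.+ d ℤ.- d ≡ b
    cancel b = trans (ℤₚ.+-assoc b d (ℤ.- d))
                     (trans (cong (λ z → b ℤ.+ z) (ℤₚ.+-inverseʳ d)) (ℤₚ.+-identityʳ b))

  lift : Operator → Laurent → Laurent
  lift T = mapSlice (λ _ → ⟦ T ⟧)
    (λ _ u p a e → R.trans (Operator.⟦⟧-cong T p a e) (Operator.0ᴹ-homo T a e))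

  p*ᴸ : ℕ → Laurent → Laurent
  p*ᴸ i = mapSlice (λ _ u a → p* i (u a))
    (λ _ u p a e → ·-zero′ (+ (suc i ℕ.* suc (exponent i e))) (p a (incr i e)))

  -- Exponent of t in s^m x^a, where x are the variables other than s
  tExponent : ℤ → Vec ℕ r → ℤ
  tExponent m a = lookup (insertAt (Vec.map +_ a) s m) zero

  t∂t : Laurent → Laurent
  t∂t = mapSlice (λ m u a → tExponent m a ·ᴾ u a)
                 (λ m u p a e → ·-zero′ (tExponent m a) (p a e))

  embed : FullSeries → Laurent
  embed F = record { slice = sl ; below = + 0 , bd }
    where
    sl : ℤ → Power
    sl (+ m)    a = F (insertAt a s m)
    sl -[1+ _ ] a = 0ᴾ
    bd : ∀ m → m ℤ.< + 0 → sl m ≈ᵁ 0ᵁ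
    bd -[1+ _ ] _ a e = R.refl
    bd (+ m) (ℤ.+<+ ())

  -- F|_{s=0}
  atZero : FullSeries → Power
  atZero F a = F (insertAt a s 0)

  -- For every n, [tⁿ]G is homogeneous of degree n − d.
  Graded : ℤ → Laurent → Set ℓ
  Graded d G = ∀ m a → Homogeneous (tExponent m a ℤ.- d) (slice G m a)

  kδ : ℕ
  kδ = k ℕ.* δₜ s

  lowest : ℤ
  lowest = 1ℤ ℤ.- + kδ

  -- L n = p_i*/s^k + L̃_i for n = i − kδ, i ≥ 1.  Only meaningful if lowest ≤ n;
  -- the number of p_i is then i − 1 = n − lowest.
  L : (ℕ → Operator) → ℤ → Laurent → Laurent
  L L̃ n G = (s^ (ℤ.- + k) ∙ p*ᴸ i G) +ᴸ lift (L̃ i) G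
    where i = ℤ.∣ n ℤ.- lowest ∣

  -- [Lₘ,Lₙ] = (m−n)Lₘ₊ₙ for the family (Lₙ), n ≥ lowest.  For m ≢ n the bracket
  -- must lie in the family again, so lowest ≤ m + n is part of the condition
  -- (it can only fail for s = t and k ≥ 3); for m = n both sides vanish.
  RepresentsVirasoro : (ℕ → Operator) → Set (c ⊔ ℓ)
  RepresentsVirasoro L̃ = ∀ m n → lowest ℤ.≤ m → lowest ℤ.≤ n → m ≢ n →
    lowest ℤ.≤ m ℤ.+ n ×
    (∀ G → L L̃ m (L L̃ n G) -ᴸ L L̃ n (L L̃ m G) ≈ᴸ (m ℤ.- n) ·ᴸ L L̃ (m ℤ.+ n) G)

{-# OPTIONS --safe #-}

-- Write Gᵢ for L_{i-kδ} F.  By homogeneity of F, t d/dt acts on F as the Euler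
-- operator Σ pᵢ pᵢ*, so the equation for F says Σ pᵢ Gᵢ = 0.  Suppose the
-- coefficients of s^(m-k) in all Gᵢ vanish.  Applying the Virasoro relations to
-- F and taking coefficients of s^(m-k) then gives pⱼ* [s^m]Gᵢ = pᵢ* [s^m]Gⱼ.
-- Hence applying pⱼ* to Σ pᵢ [s^m]Gᵢ = 0 yields (Σ pᵢ pᵢ* + j) [s^m]Gⱼ = 0, where
-- Σ pᵢ pᵢ* + j multiplies each coefficient by a positive integer; so [s^m]Gⱼ = 0.
module Submission where

open import Defs
open import Algebra.Bundles using (Ring)
import Algebra.Properties.CommutativeMonoid.Mult as Mult
import Algebra.Properties.CommutativeSemigroup as CommutativeSemigroupProperties
import Algebra.Properties.Group as GroupProperties
open import Data.Fin.Base using (Fin)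
open import Data.Integer.Base as ℤ using (ℤ; +_; -[1+_]; 1ℤ; -1ℤ)
import Data.Integer.Properties as ℤₚ
open import Data.List.Base using ([]; _∷_; _++_; [_]; length; replicate)
import Data.List.Properties as Listₚ
open import Data.Nat.Base as ℕ using (ℕ; zero; suc; s≤s; NonZero)
import Data.Nat.Properties as ℕₚ
open import Data.Nat.Tactic.RingSolver using (solve-∀)
open import Data.Product.Base using (∃; _,_; proj₁; proj₂)
open import Relation.Nullary using (yes; no; contradiction)
open import Relation.Binary.PropositionalEquality as ≡ using (_≡_; _≢_; cong; cong₂; subst)
import Relation.Binary.Reasoning.Setoid as SetoidReasoning

-- Monomials: exponents and weighted degree.

exponent-incr : ∀ i e → exponent i (incr i e) ≡ suc (exponent i e)
exponent-incr zero    []      = ≡.refl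
exponent-incr (suc i) []      = exponent-incr i []
exponent-incr zero    (x ∷ e) = ≡.refl
exponent-incr (suc i) (x ∷ e) = exponent-incr i e

exponent-incr-≢ : ∀ i j e → i ≢ j → exponent i (incr j e) ≡ exponent i e
exponent-incr-≢ zero    zero    e       i≢j = contradiction ≡.refl i≢j
exponent-incr-≢ zero    (suc j) []      i≢j = ≡.refl
exponent-incr-≢ zero    (suc j) (x ∷ e) i≢j = ≡.refl
exponent-incr-≢ (suc i) zero    []      i≢j = ≡.refl
exponent-incr-≢ (suc i) zero    (x ∷ e) i≢j = ≡.refl
exponent-incr-≢ (suc i) (suc j) []      i≢j = exponent-incr-≢ i j [] (λ p → i≢j (cong suc p))
exponent-incr-≢ (suc i) (suc j) (x ∷ e) i≢j = exponent-incr-≢ i j e (λ p → i≢j (cong suc p))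

exponent-decr : ∀ i e {m} → exponent i e ≡ suc m → exponent i (decr i e) ≡ m
exponent-decr zero    (x ∷ e) eq = cong ℕ.pred eq
exponent-decr (suc i) (x ∷ e) eq = exponent-decr i e eq

exponent-decr-≢ : ∀ i j e → i ≢ j → exponent i (decr j e) ≡ exponent i e
exponent-decr-≢ i       j       []      i≢j = ≡.refl
exponent-decr-≢ zero    zero    (x ∷ e) i≢j = contradiction ≡.refl i≢j
exponent-decr-≢ zero    (suc j) (x ∷ e) i≢j = ≡.refl
exponent-decr-≢ (suc i) zero    (x ∷ e) i≢j = ≡.refl
exponent-decr-≢ (suc i) (suc j) (x ∷ e) i≢j = exponent-decr-≢ i j e (λ p → i≢j (cong suc p))

decr-incr-≢ : ∀ i j e {m} → i ≢ j → exponent i e ≡ suc m →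
              decr i (incr j e) ≡ incr j (decr i e)
decr-incr-≢ zero    zero    (x ∷ e) i≢j eq = contradiction ≡.refl i≢j
decr-incr-≢ zero    (suc j) (x ∷ e) i≢j eq = ≡.refl
decr-incr-≢ (suc i) zero    (x ∷ e) i≢j eq = ≡.refl
decr-incr-≢ (suc i) (suc j) (x ∷ e) i≢j eq =
  cong (x ∷_) (decr-incr-≢ i j e (λ p → i≢j (cong suc p)) eq)

-- `incr` may lengthen the list and `decr` never shortens it, so they cancel only up to trailing
-- zeros, which `coeff` ignores.
decr-incr : ∀ i e → ∃ λ n → decr i (incr i e) ≡ e ++ replicate n 0
decr-incr zero    []      = 1 , ≡.refl
decr-incr (suc i) []      = let n , eq = decr-incr i [] in suc n , cong (0 ∷_) eq
decr-incr zero    (x ∷ e) = 0 , cong (x ∷_) (≡.sym (Listₚ.++-identityʳ e))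
decr-incr (suc i) (x ∷ e) = let n , eq = decr-incr i e in n , cong (x ∷_) eq

-- Grows by its last term, as `∑<` does, whereas `degreeFrom` splits off the first exponent.
partialDegree : ℕ → Monomial → ℕ → ℕ
partialDegree w e zero    = 0
partialDegree w e (suc m) = partialDegree w e m ℕ.+ (w ℕ.+ m) ℕ.* exponent m e

partialDegree-∷ : ∀ w x e m →
  partialDegree w (x ∷ e) (suc m) ≡ w ℕ.* x ℕ.+ partialDegree (suc w) e m
partialDegree-∷ w x e zero    = lem w x
  where lem : ∀ w x → (w ℕ.+ 0) ℕ.* x ≡ w ℕ.* x ℕ.+ 0
        lem = solve-∀
partialDegree-∷ w x e (suc m) = ≡.trans
  (cong (ℕ._+ (w ℕ.+ suc m) ℕ.* exponent m e) (partialDegree-∷ w x e m))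
  (lem (w ℕ.* x) (partialDegree (suc w) e m) w m (exponent m e))
  where lem : ∀ a b w m y → a ℕ.+ b ℕ.+ (w ℕ.+ suc m) ℕ.* y ≡ a ℕ.+ (b ℕ.+ (suc w ℕ.+ m) ℕ.* y)
        lem = solve-∀

partialDegree-degreeFrom : ∀ w e m → length e ℕ.≤ m → partialDegree w e m ≡ degreeFrom w e
partialDegree-degreeFrom w []      zero    _         = ≡.refl
partialDegree-degreeFrom w []      (suc m) _         =
  cong₂ ℕ._+_ (partialDegree-degreeFrom w [] m ℕ.z≤n) (ℕₚ.*-zeroʳ (w ℕ.+ m))
partialDegree-degreeFrom w (x ∷ e) (suc m) (s≤s l≤m) =
  ≡.trans (partialDegree-∷ w x e m)
          (cong (w ℕ.* x ℕ.+_) (partialDegree-degreeFrom (suc w) e m l≤m))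

-- Finite sums and the Euler operator Σ pᵢ pᵢ*.

module _ {c ℓ} (R : Ring c ℓ) where

  open Ring R
  open Polynomials R
  open Mult +-commutativeMonoid using (×-congʳ; ×-congˡ; ×-homo-+; ×-assocˡ; ×-distrib-+)
    renaming (_×_ to _×ᴿ_)
  open CommutativeSemigroupProperties +-commutativeSemigroup using (interchange)
  open SetoidReasoning setoid

  ∑< : ℕ → (ℕ → Carrier) → Carrier
  ∑< zero    f = 0#
  ∑< (suc m) f = ∑< m f + f m

  ∑<-cong : ∀ m {f g} → (∀ i → f i ≈ g i) → ∑< m f ≈ ∑< m g
  ∑<-cong zero    f≈g = refl
  ∑<-cong (suc m) f≈g = +-cong (∑<-cong m f≈g) (f≈g m)

  ∑<-distrib-+ : ∀ m f g → ∑< m (λ i → f i + g i) ≈ ∑< m f + ∑< m g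
  ∑<-distrib-+ zero    f g = sym (+-identityˡ 0#)
  ∑<-distrib-+ (suc m) f g = trans (+-congʳ (∑<-distrib-+ m f g)) (interchange _ _ _ _)

  ×-distribˡ-∑< : ∀ n m f → n ×ᴿ ∑< m f ≈ ∑< m (λ i → n ×ᴿ f i)
  ×-distribˡ-∑< n zero    f = ·-zero (+ n)
  ×-distribˡ-∑< n (suc m) f =
    trans (×-distrib-+ (∑< m f) (f m) n) (+-congʳ (×-distribˡ-∑< n m f))

  -- Variables beyond the end of the list have exponent 0, so every cutoff from `length e` on gives
  -- the full degree.
  ∑<-degree : ∀ e x m → length e ℕ.≤ m →
              ∑< m (λ i → (suc i ℕ.* exponent i e) ×ᴿ x) ≈ degree e ×ᴿ x
  ∑<-degree e x m l≤m = trans (step m) (×-congˡ (partialDegree-degreeFrom 1 e m l≤m))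
    where
    step : ∀ m → ∑< m (λ i → (suc i ℕ.* exponent i e) ×ᴿ x) ≈ partialDegree 1 e m ×ᴿ x
    step zero    = refl
    step (suc m) = trans (+-congʳ (step m)) (sym (×-homo-+ x (partialDegree 1 e m) _))

  ifPositive-+ : ∀ n x y → ifPositive n (x + y) ≈ ifPositive n x + ifPositive n y
  ifPositive-+ zero    x y = sym (+-identityˡ 0#)
  ifPositive-+ (suc n) x y = refl

  coeff-padding : ∀ f e n → coeff f (e ++ replicate n 0) ≈ coeff f e
  coeff-padding f e zero    = reflexive (cong (coeff f) (Listₚ.++-identityʳ e))
  coeff-padding f e (suc n) = begin
    coeff f (e ++ [ 0 ] ++ replicate n 0)    ≡⟨ cong (coeff f) (Listₚ.++-assoc e [ 0 ] _) ⟨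
    coeff f ((e ++ [ 0 ]) ++ replicate n 0)  ≈⟨ coeff-padding f (e ++ [ 0 ]) n ⟩
    coeff f (e ++ [ 0 ])                     ≈⟨ trailing f e ⟩
    coeff f e                                ∎

  coeff-decr-incr : ∀ f i e → coeff f (decr i (incr i e)) ≈ coeff f e
  coeff-decr-incr f i e = let n , eq = decr-incr i e in
    trans (reflexive (cong (coeff f) eq)) (coeff-padding f e n)

  coeff-p* : ∀ i f e {n} → exponent i e ≡ suc n →
             coeff (p* i f) (decr i e) ≈ (suc i ℕ.* exponent i e) ×ᴿ coeff f e
  coeff-p* i f e eq rewrite exponent-decr i e eq | incr-decr i e eq | eq = refl

  -- Each monomial is an eigenvector of pᵢ pᵢ*, because `decr i` followed by `incr i` restores it
  -- whenever the variable occurs.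
  coeff-mulP-p* : ∀ i f e →
    coeff (mulP i (p* i f)) e ≈ (suc i ℕ.* exponent i e) ×ᴿ coeff f e
  coeff-mulP-p* i f e with exponent i e in eq
  ... | zero  = sym (×-congˡ (ℕₚ.*-zeroʳ (suc i)))
  ... | suc n = trans (coeff-p* i f e eq) (×-congˡ (cong (suc i ℕ.*_) eq))

  euler : ∀ f e m → length e ℕ.≤ m →
          ∑< m (λ i → coeff (mulP i (p* i f)) e) ≈ degree e ×ᴿ coeff f e
  euler f e m l≤m = trans (∑<-cong m (λ i → coeff-mulP-p* i f e)) (∑<-degree e (coeff f e) m l≤m)

  -- Families with Σ pᵢ gᵢ = 0 and pⱼ* gᵢ = pᵢ* gⱼ.

  module _ (g : ℕ → Poly) (p*-symmetric : ∀ i j → i ≢ j → p* j (g i) ≈ᴾ p* i (g j)) where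

    -- The left-hand side is the coefficient of e in pⱼ* (pᵢ gᵢ).
    coeff-p*-mulP : ∀ i j e →
      (suc j ℕ.* suc (exponent j e)) ×ᴿ coeff (mulP i (g i)) (incr j e)
        ≈ (suc i ℕ.* exponent i (incr j e)) ×ᴿ coeff (g j) e
    coeff-p*-mulP i j e with i ℕₚ.≟ j
    -- On the diagonal the exponent exceeds that in `e` by one; this unit is the commutator of pⱼ*
    -- with pⱼ and gives the summand j in Σ pᵢ pᵢ* + j.
    ... | yes ≡.refl rewrite exponent-incr i e =
      ×-congʳ (suc i ℕ.* suc (exponent i e)) (coeff-decr-incr (g i) i e)
    -- Off the diagonal pⱼ* commutes with multiplication by pᵢ, and the symmetry turns pⱼ* gᵢ into
    -- pᵢ* gⱼ. If pᵢ does not occur in `e`, both sides are zero.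
    ... | no i≢j rewrite exponent-incr-≢ i j e i≢j with exponent i e in eq
    ...   | zero  = trans (·-zero (+ (suc j ℕ.* suc (exponent j e))))
                          (sym (×-congˡ (ℕₚ.*-zeroʳ (suc i))))
    ...   | suc n rewrite decr-incr-≢ i j e i≢j eq = begin
      (suc j ℕ.* suc (exponent j e)) ×ᴿ coeff (g i) (incr j (decr i e))
        ≡⟨ cong (λ x → (suc j ℕ.* suc x) ×ᴿ coeff (g i) (incr j (decr i e)))
                (exponent-decr-≢ j i e (λ p → i≢j (≡.sym p))) ⟨
      coeff (p* j (g i)) (decr i e)
        ≈⟨ p*-symmetric i j i≢j (decr i e) ⟩
      coeff (p* i (g j)) (decr i e)
        ≈⟨ trans (coeff-p* i (g j) e eq) (×-congˡ (cong (suc i ℕ.*_) eq)) ⟩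
      (suc i ℕ.* suc n) ×ᴿ coeff (g j) e
        ∎

    -- The coefficient of `e` in pⱼ* Σ pᵢ gᵢ is that of gⱼ times the degree of `incr j e`, which is
    -- positive and cancels by torsion-freeness.
    ∑pᵢgᵢ≈0⇒gⱼ≈0 : TorsionFree R →
      (∀ e → ∃ λ N → ∀ m → N ℕ.≤ m → ∑< m (λ i → coeff (mulP i (g i)) e) ≈ 0#) →
      ∀ j → g j ≈ᴾ 0ᴾ
    ∑pᵢgᵢ≈0⇒gⱼ≈0 torsionFree ∑≈0 j e = torsionFree (j ℕ.+ degree e) (coeff (g j) e) (begin
      suc (j ℕ.+ degree e) ×ᴿ coeff (g j) e
        ≡⟨ cong (_×ᴿ coeff (g j) e) (degreeFrom-incr 1 j e) ⟨
      degree (incr j e) ×ᴿ coeff (g j) e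
        ≈⟨ ∑<-degree (incr j e) (coeff (g j) e) m (ℕₚ.m≤n⊔m N _) ⟨
      ∑< m (λ i → (suc i ℕ.* exponent i (incr j e)) ×ᴿ coeff (g j) e)
        ≈⟨ ∑<-cong m (λ i → coeff-p*-mulP i j e) ⟨
      ∑< m (λ i → C ×ᴿ coeff (mulP i (g i)) (incr j e))
        ≈⟨ ×-distribˡ-∑< C m _ ⟨
      C ×ᴿ ∑< m (λ i → coeff (mulP i (g i)) (incr j e))
        ≈⟨ ·-cong (+ C) (proj₂ (∑≈0 (incr j e)) m (ℕₚ.m≤m⊔n N _)) ⟩
      C ×ᴿ 0#
        ≈⟨ ·-zero (+ C) ⟩
      0#
        ∎)
      where
      C = suc j ℕ.* suc (exponent j e)
      N = proj₁ (∑≈0 (incr j e))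
      -- Large enough for the sum at `incr j e` to have reached its limit and to include every
      -- variable of that monomial.
      m = N ℕ.⊔ length (incr j e)

  -1ℤ·x≈-x : ∀ x → -1ℤ · x ≈ - x
  -1ℤ·x≈-x x = -‿cong (+-identityʳ x)

  -- `-ᴸ` adds the `-1ℤ`-multiple, so vanishing brackets arrive in this form.
  x-y≈0⇒x≈y : ∀ {x y} → x + -1ℤ · y ≈ 0# → x ≈ y
  x-y≈0⇒x≈y {x} {y} eq = GroupProperties.x∙y⁻¹≈ε⇒x≈y +-group x y
    (trans (+-congˡ (sym (-1ℤ·x≈-x y))) eq)

  coeff-partialSum : ∀ {n} (u : ℕ → Series.Power R n) m a e →
    coeff (Series.partialSum R n u m a) e ≡ ∑< m (λ i → coeff (u i a) e)
  coeff-partialSum u zero    a e = ≡.refl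
  coeff-partialSum u (suc m) a e = cong (_+ coeff (u m a) e) (coeff-partialSum u m a e)

  -- Trades the exponent of t, by which `t∂t` multiplies, for the degree in p, by which the Euler
  -- operator multiplies.
  Homogeneous⇒·-degree : ∀ {d f} → Homogeneous d f → ∀ e → d · coeff f e ≈ degree e ×ᴿ coeff f e
  Homogeneous⇒·-degree {d} {f} hom e with + degree e ℤₚ.≟ d
  ... | yes ≡.refl = refl
  ... | no  ≢d     = begin
    d · coeff f e         ≈⟨ ·-cong d (hom e ≢d) ⟩
    d · 0#                ≈⟨ ·-zero d ⟩
    0#                    ≈⟨ ·-zero (+ degree e) ⟨
    degree e ×ᴿ 0#        ≈⟨ ·-cong (+ degree e) (hom e ≢d) ⟨
    degree e ×ᴿ coeff f e ∎

i-j+j≡i : ∀ i j → i ℤ.- j ℤ.+ j ≡ i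
i-j+j≡i i j = ≡.trans (ℤₚ.+-assoc i (ℤ.- j) j)
  (≡.trans (cong (λ z → i ℤ.+ z) (ℤₚ.+-inverseˡ j)) (ℤₚ.+-identityʳ i))

i+j-i≡j : ∀ i j → i ℤ.+ j ℤ.- i ≡ j
i+j-i≡j i j = ≡.trans (cong (ℤ._- i) (ℤₚ.+-comm i j))
  (≡.trans (ℤₚ.+-assoc j i (ℤ.- i))
    (≡.trans (cong (λ z → j ℤ.+ z) (ℤₚ.+-inverseʳ i)) (ℤₚ.+-identityʳ j)))

-- Vanishing of all Lᵢ F by induction on the order in s.

module _ {c ℓ} (R : Ring c ℓ) (torsionFree : TorsionFree R)
         {r : ℕ} (s : Fin (suc r)) (k : ℕ) .{{_ : NonZero k}} where

  open Ring R
  open Constraints R s k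
  open Mult +-commutativeMonoid using () renaming (_×_ to _×ᴿ_)
  open SetoidReasoning setoid

  module _ (F : FullSeries) (graded : Graded (+ 0) (embed F))
           (A : Operator) (L̃ : ℕ → Operator)
           (equation : t∂t (embed F) +ᴸ (s^ (+ k) ∙ lift A (embed F)) ≈ᴸ 0ᴸ)
           (A≈Σp : A ≈Σp L̃) (virasoro : RepresentsVirasoro L̃) where

    -- The family numbered from 0: `L L̃ n` is by definition `Lᵢ ∣ n - lowest ∣`.
    Lᵢ : ℕ → Laurent → Laurent
    Lᵢ i G = (s^ (ℤ.- + k) ∙ p*ᴸ i G) +ᴸ lift (L̃ i) G

    -- The multiple `z` and index `l` stay existential: the relation is applied at an order in s
    -- where every `Lᵢ l` already annihilates `F`.
    Lᵢ-bracket : ∀ i j → i ≢ j → ∃ λ z → ∃ λ l → ∀ G →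
      Lᵢ i (Lᵢ j G) -ᴸ Lᵢ j (Lᵢ i G) ≈ᴸ z ·ᴸ Lᵢ l G
    Lᵢ-bracket i j i≢j = n i ℤ.- n j , ℤ.∣ n i ℤ.+ n j ℤ.- lowest ∣ , bracket
      where
      n : ℕ → ℤ
      n i = lowest ℤ.+ + i

      index : ∀ i → ℤ.∣ n i ℤ.- lowest ∣ ≡ i
      index i = cong ℤ.∣_∣ (i+j-i≡j lowest (+ i))

      n-injective : n i ≡ n j → i ≡ j
      n-injective eq = ≡.trans (≡.sym (index i))
        (≡.trans (cong (λ m → ℤ.∣ m ℤ.- lowest ∣) eq) (index j))

      bracket : ∀ G → Lᵢ i (Lᵢ j G) -ᴸ Lᵢ j (Lᵢ i G)
                    ≈ᴸ (n i ℤ.- n j) ·ᴸ Lᵢ ℤ.∣ n i ℤ.+ n j ℤ.- lowest ∣ G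
      bracket G = ≡.subst₂
        (λ x y → Lᵢ x (Lᵢ y G) -ᴸ Lᵢ y (Lᵢ x G)
               ≈ᴸ (n i ℤ.- n j) ·ᴸ Lᵢ ℤ.∣ n i ℤ.+ n j ℤ.- lowest ∣ G)
        (index i) (index j)
        (proj₂ (virasoro (n i) (n j) (ℤₚ.i≤i+j lowest (+ i)) (ℤₚ.i≤i+j lowest (+ j))
                         (λ eq → i≢j (n-injective eq))) G)

    -- The terms pᵢ*/s^k sum to the Euler operator, which is t d/dt on the homogeneous `F`, and the
    -- terms `L̃ i` sum to `A`: the total is s^(-k) times the equation.
    ∑pᵢLᵢF≈0 : ∀ m a e → ∃ λ N → ∀ M → N ℕ.≤ M →
      ∑< R M (λ i → coeff (mulP i (slice (Lᵢ i (embed F)) m a)) e) ≈ 0#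
    ∑pᵢLᵢF≈0 m a e = N ℕ.⊔ length e , λ M N≤M → begin
      ∑< R M (λ i → coeff (mulP i (slice (Lᵢ i (embed F)) m a)) e)
        ≈⟨ ∑<-cong R M (λ i → ifPositive-+ R (exponent i e) _ _) ⟩
      ∑< R M (λ i → coeff (mulP i (p* i (slice (embed F) m⁺ a))) e
                  + coeff (mulP i (⟦ L̃ i ⟧ (slice (embed F) m) a)) e)
        ≈⟨ ∑<-distrib-+ R M _ _ ⟩
      ∑< R M (λ i → coeff (mulP i (p* i (slice (embed F) m⁺ a))) e)
        + ∑< R M (λ i → coeff (mulP i (⟦ L̃ i ⟧ (slice (embed F) m) a)) e)
        ≈⟨ +-cong (euler R (slice (embed F) m⁺ a) e M (ℕₚ.m⊔n≤o⇒n≤o N _ N≤M))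
                  (reflexive (≡.sym (coeff-partialSum R _ M a e))) ⟩
      degree e ×ᴿ coeff (slice (embed F) m⁺ a) e
        + coeff (partialSum (λ i a → mulP i (⟦ L̃ i ⟧ (slice (embed F) m) a)) M a) e
        ≈⟨ +-cong (sym (Homogeneous⇒·-degree R {f = slice (embed F) m⁺ a} homogeneous e))
                  (proj₂ (A≈Σp (slice (embed F) m) a e) M (ℕₚ.m⊔n≤o⇒m≤o N _ N≤M)) ⟩
      tExponent m⁺ a · coeff (slice (embed F) m⁺ a) e + coeff (⟦ A ⟧ (slice (embed F) m) a) e
        -- The equation is read at s^(m+k), where s^k `A` contributes the slice `m⁺ - k`, which is
        -- `m`.
        ≈⟨ subst (λ z → tExponent m⁺ a · coeff (slice (embed F) m⁺ a) e
                      + coeff (⟦ A ⟧ (slice (embed F) z) a) e ≈ 0#)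
                 (i-j+j≡i m (ℤ.- + k)) (equation m⁺ a e) ⟩
      0# ∎
      where
      m⁺ = m ℤ.- ℤ.- + k
      N = proj₁ (A≈Σp (slice (embed F) m) a e)
      homogeneous : Homogeneous (tExponent m⁺ a) (slice (embed F) m⁺ a)
      homogeneous = subst (λ d → Homogeneous d (slice (embed F) m⁺ a))
                          (ℤₚ.+-identityʳ (tExponent m⁺ a)) (graded m⁺ a)

    ⟦⟧-zero : ∀ T {u} → u ≈ᵁ 0ᵁ → ⟦ T ⟧ u ≈ᵁ 0ᵁ
    ⟦⟧-zero T u≈0 a e = trans (Operator.⟦⟧-cong T u≈0 a e) (Operator.0ᴹ-homo T a e)

    slice-LᵢF≈0-step : ∀ m → (∀ i → slice (Lᵢ i (embed F)) m ≈ᵁ 0ᵁ) →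
      ∀ i → slice (Lᵢ i (embed F)) (m ℤ.- ℤ.- + k) ≈ᵁ 0ᵁ
    slice-LᵢF≈0-step m ih i a =
      ∑pᵢgᵢ≈0⇒gⱼ≈0 R g symmetric torsionFree (∑pᵢLᵢF≈0 m⁺ a) i
      where
      m⁺ = m ℤ.- ℤ.- + k

      g : ℕ → Poly
      g i = slice (Lᵢ i (embed F)) m⁺ a

      -- `L̃ i` is independent of s, so it acts on the order-`m` slice of LⱼF, zero by `ih`; only
      -- pᵢ*/s^k remains, reading the slice at `m⁺`.
      coeff-LᵢLⱼF : ∀ i j e → coeff (slice (Lᵢ i (Lᵢ j (embed F))) m a) e ≈ coeff (p* i (g j)) e
      coeff-LᵢLⱼF i j e = trans (+-congˡ (⟦⟧-zero (L̃ i) (ih j) a e)) (+-identityʳ _)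

      symmetric : ∀ i j → i ≢ j → p* j (g i) ≈ᴾ p* i (g j)
      symmetric i j i≢j e = let z , l , bracket = Lᵢ-bracket i j i≢j in begin
        coeff (p* j (g i)) e
          ≈⟨ coeff-LᵢLⱼF j i e ⟨
        coeff (slice (Lᵢ j (Lᵢ i (embed F))) m a) e
          -- At order `m` the bracket is a multiple of a slice that vanishes by `ih`.
          ≈⟨ x-y≈0⇒x≈y R (trans (bracket (embed F) m a e)
               (trans (·-cong z (ih l a e)) (·-zero z))) ⟨
        coeff (slice (Lᵢ i (Lᵢ j (embed F))) m a) e
          ≈⟨ coeff-LᵢLⱼF i j e ⟩
        coeff (p* i (g j)) e
          ∎

    -- Induction on a bound for m + k, the highest order of `F` involved. At the start this is
    -- negative, where a power series has no terms.
    slice-LᵢF≈0 : ∀ N m → m ℤ.+ + k ℤ.< + N → ∀ i → slice (Lᵢ i (embed F)) m ≈ᵁ 0ᵁ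
    slice-LᵢF≈0 zero    m m+k<0 i a e = begin
      _ ≈⟨ +-cong (·-cong (+ (suc i ℕ.* suc (exponent i e)))
                          (proj₂ (below (embed F)) (m ℤ.- ℤ.- + k) m⁺<0 a (incr i e)))
                  (⟦⟧-zero (L̃ i) (proj₂ (below (embed F)) m m<0) a e) ⟩
      _ ≈⟨ +-congʳ (·-zero (+ (suc i ℕ.* suc (exponent i e)))) ⟩
      0# + 0# ≈⟨ +-identityˡ 0# ⟩
      0# ∎
      where
      m⁺<0 : m ℤ.- ℤ.- + k ℤ.< + 0
      m⁺<0 = subst (λ z → m ℤ.+ z ℤ.< + 0) (≡.sym (ℤₚ.neg-involutive (+ k))) m+k<0
      m<0 : m ℤ.< + 0
      m<0 = ℤₚ.≤-<-trans (ℤₚ.i≤i+j m (+ k)) m+k<0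
    slice-LᵢF≈0 (suc N) m m+k<N i =
      subst (λ z → slice (Lᵢ i (embed F)) z ≈ᵁ 0ᵁ)
            (≡.trans (cong (λ z → m ℤ.- + k ℤ.+ z) (ℤₚ.neg-involutive (+ k))) (i-j+j≡i m (+ k)))
            (slice-LᵢF≈0-step (m ℤ.- + k) (slice-LᵢF≈0 N (m ℤ.- + k) m<N) i)
      where
      m<m+k : m ℤ.< m ℤ.+ + k
      m<m+k = subst (ℤ._< m ℤ.+ + k) (ℤₚ.+-identityʳ m)
                    (ℤₚ.+-monoʳ-< m (ℤ.+<+ (ℕ.>-nonZero⁻¹ k)))
      -- The order drops by k while the bound drops by one; this works since k is positive, giving m
      -- < m + k ≤ N.
      m<N : m ℤ.- + k ℤ.+ + k ℤ.< + N
      m<N = subst (ℤ._< + N) (≡.sym (i-j+j≡i m (+ k)))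
                  (ℤₚ.<-≤-trans m<m+k (ℤₚ.i<j⇒i≤pred[j] m+k<N))

    LᵢF≈0 : ∀ i → Lᵢ i (embed F) ≈ᴸ 0ᴸ
    LᵢF≈0 i m = slice-LᵢF≈0 (suc ℤ.∣ m ℤ.+ + k ∣) m (<1+∣∣ (m ℤ.+ + k)) i
      where
      <1+∣∣ : ∀ z → z ℤ.< + suc ℤ.∣ z ∣
      <1+∣∣ (+ n)    = ℤ.+<+ (ℕₚ.n<1+n n)
      <1+∣∣ -[1+ n ] = ℤ.-<+

lemma2p6 : ∀ {c ℓ} (R : Ring c ℓ) → TorsionFree R →
    ∀ (r : ℕ) (s : Fin (suc r)) (k : ℕ) .{{_ : NonZero k}} →
    let open Constraints R s k in
    (F : FullSeries) → Graded (+ 0) (embed F) →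
    (A : Operator) (L̃ : ℕ → Operator) →
    t∂t (embed F) +ᴸ (s^ (+ k) ∙ lift A (embed F)) ≈ᴸ 0ᴸ →
    (∀ i → (λ a → p* i (atZero F a)) ≈ᵁ 0ᵁ) →
    (∀ n → lowest ℤ.≤ n → Graded n (L L̃ n (embed F))) →
    A ≈Σp L̃ →
    RepresentsVirasoro L̃ →
    ∀ n → lowest ℤ.≤ n → L L̃ n (embed F) ≈ᴸ 0ᴸ
lemma2p6 R torsionFree r s k F graded A L̃ equation _ _ A≈Σp virasoro n _ =
  LᵢF≈0 R torsionFree s k F graded A L̃ equation A≈Σp virasoro ℤ.∣ n ℤ.- lowest ∣
  where open Constraints R s k using (lowest)
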